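{- Let $\mathcal{F} \subseteq \binom{[n]}{\leq u}$ be $(2,s)$-conditionally intersecting, where $\frac{s}{2} < u < s-1$. If $s=2k$, then \[ |\mathcal{F}| \leq \binom{n-1}{k-1}+\sum_{i=k+1}^u \binom{n}{i}, \] and, for $n$ sufficiently larger than $s$, equality holds if and only if, up to isomorphism (i.e. up to a permutation of $[n]$), \[ \mathcal{F} = \left\{ F\in \binom{[n]}{k} : 1\in F\right\} \cup \{F\in 2^{[n]} : k<|F|\leq u\}. \] If $s=2k-1$, then \[ |\mathcal{F}| \leq \sum_{i=k}^u \binom{n}{i}, \] and, for $n$ sufficiently larger than $s$, equality holds if and only if, up to isomorphism, \[ \mathcal{F} = \{F\in 2^{[n]} : k\leq |F|\leq u\}. \]
   Context: Here $n$, $s$, $u$, $k$ are positive integers, $[n]=\{1,\ldots,n\}$, $2^{[n]}$ is its power set, $\binom{[n]}{k}$ is the family of all $k$-element subsets of $[n]$, and $\binom{[n]}{\leq u} = \{X\subseteq[n] : |X|\leq u\}$. A family $\mathcal{F} \subseteq 2^{[n]}$ is $(2,s)$-conditionally intersecting if, for each $A,B\in\mathcal{F}$, $A \cap B \neq \emptyset$ whenever $|A \cup B| \leq s$.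
   Formalization: The two upper bounds, like the equality cases, are stated only for n sufficiently larger than s, since they fail for small n (e.g. s=6, u=4, n=6: the sets of size at most 4 containing 1 number 26, above the bound 25). -}

module Defs where

open import Data.Fin.Base using (Fin; zero)
open import Data.Fin.Permutation using (Permutation′; _⟨$⟩ˡ_)
open import Data.Fin.Subset using (Subset; ∣_∣; _∪_; _∩_; Nonempty)
  renaming (_∈_ to _∈ˢ_)
open import Data.List.Base using (List; length; applyUpTo)
open import Data.List.Membership.Propositional using () renaming (_∈_ to _∈ˡ_)
open import Data.List.Relation.Unary.Unique.Propositional using (Unique)
open import Data.Nat.Base using (ℕ; suc; _+_; _∸_; _≤_; _<_; NonZero)
open import Data.Nat.ListAction using (sum)
open import Data.Product.Base using (_×_; ∃)
open import Data.Sum.Base using (_⊎_)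
open import Data.Vec.Base using (lookup; tabulate)
open import Function.Bundles using (_⇔_)
open import Level using (0ℓ)
open import Relation.Binary.PropositionalEquality.Core using (_≡_)
open import Relation.Unary using (Pred)

record Family (n : ℕ) : Set where
  constructor family
  field
    members : List (Subset n)
    unique  : Unique members

open Family public

infix 4 _∈ᶠ_

_∈ᶠ_ : ∀ {n} → Subset n → Family n → Set
X ∈ᶠ F = X ∈ˡ members F

∣_∣ᶠ : ∀ {n} → Family n → ℕ
∣ F ∣ᶠ = length (members F)

_⊆[≤_] : ∀ {n} → Family n → ℕ → Set
F ⊆[≤ u ] = ∀ {X} → X ∈ᶠ F → ∣ X ∣ ≤ u

-- A and B may coincide; in particular such a family never contains ∅.
[2,_]-ConditionallyIntersecting : ∀ {n} → ℕ → Family n → Set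
[2, s ]-ConditionallyIntersecting F =
  ∀ {A B} → A ∈ᶠ F → B ∈ᶠ F → ∣ A ∪ B ∣ ≤ s → Nonempty (A ∩ B)

-- ∑[ a ⋯ b ] f = f a + f (a + 1) + … + f b, which is 0 when b < a.
∑[_⋯_] : ℕ → ℕ → (ℕ → ℕ) → ℕ
∑[ a ⋯ b ] f = sum (applyUpTo (λ i → f (a + i)) (suc b ∸ a))

-- The image π(X): i ∈ π(X) exactly when π⁻¹(i) ∈ X.
image : ∀ {n} → Permutation′ n → Subset n → Subset n
image π X = tabulate (λ i → lookup X (π ⟨$⟩ˡ i))

-- The family {π(X) : X ∈ F} is G for some permutation π of the ground set.
infix 4 _≅_

_≅_ : ∀ {n} → Family n → Pred (Subset n) 0ℓ → Set
_≅_ {n} F G = ∃ λ (π : Permutation′ n) → ∀ X → X ∈ᶠ F ⇔ G (image π X)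

-- The ground set [n] = {1,…,n} is represented by Fin n, so 1 becomes zero.
one : ∀ n → .{{NonZero n}} → Fin n
one (suc n) = zero

EvenExtremal : ∀ n → .{{NonZero n}} → (k u : ℕ) → Pred (Subset n) 0ℓ
EvenExtremal n k u X = (∣ X ∣ ≡ k × one n ∈ˢ X) ⊎ (k < ∣ X ∣ × ∣ X ∣ ≤ u)

OddExtremal : ∀ n → (k u : ℕ) → Pred (Subset n) 0ℓ
OddExtremal n k u X = k ≤ ∣ X ∣ × ∣ X ∣ ≤ u

{-# OPTIONS --safe #-}
module Submission where

-- For large n a member A that is too small is expensive: with m = k when s = 2k − 1 and m = k + 1 when
-- s = 2k, every m-element member meets A, so C(n − |A|, m) sets of size m are missing, which exceeds the
-- number O(n^(m−1)) of all sets of size below m.  Hence a family of at least the extremal size has only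
-- members of size ≥ k.  This settles s = 2k − 1.  For s = 2k the k-element members are pairwise
-- intersecting: either they share an element, or there are at most k² C(n − 2, k − 2) < C(n − 1, k − 1).

open import Defs
open import Algebra.Properties.CommutativeMonoid.Sum as MonoidSum using ()
open import Data.Bool.Base using (if_then_else_)
open import Data.Bool.Properties as Bool using ()
open import Data.Fin.Base using (Fin; zero; suc)
open import Data.Fin.Permutation using (Permutation′; _⟨$⟩ˡ_; flip; transpose) renaming (id to idₚ)
open import Data.Fin.Properties as Fin using ()
open import Data.Fin.Subset
  using (Subset; inside; outside; ∣_∣; _∈_; _∉_; _⊆_; _∪_; _∩_; ∁; ⁅_⁆; ⊤; ⊥; Nonempty)
open import Data.Fin.Subset.Properties
open import Data.List.Base using (List; []; _∷_; length; applyUpTo)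
open import Data.List.Membership.DecPropositional as DecMembership using ()
open import Data.List.Membership.Propositional using (find; lose)
open import Data.List.Relation.Unary.All as All using (_∷_)
open import Data.List.Relation.Unary.AllPairs using ([]; _∷_)
open import Data.List.Relation.Unary.Any as Any using ()
open import Data.List.Relation.Unary.Unique.Propositional using (Unique)
open import Data.Nat.Base
open import Data.Nat.Combinatorics using (_C_; nCn≡1; nCk≡nC[n∸k]; k>n⇒nCk≡0; nCk+nC[k+1]≡[n+1]C[k+1])
open import Data.Nat.DivMod using (_/_; _%_; m*n/n≡m; m/n*n≤m; /-monoˡ-≤; m≡m%n+[m/n]*n; m%n<n)
open import Data.Nat.ListAction using (sum)
open import Data.Nat.Properties
open import Data.Product.Base using (_×_; _,_; ∃; proj₁; proj₂)
open import Data.Sum.Base using (_⊎_; inj₁; inj₂; [_,_])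
open import Data.Unit.Base using (tt) renaming (⊤ to Unit)
open import Data.Vec.Base using ([]; _∷_; lookup; here; there)
open import Data.Vec.Properties using (≡-dec; lookup∘tabulate; []=⇒lookup; lookup⇒[]=)
open import Function.Base using (_∘_; case_of_)
open import Function.Bundles using (_⇔_; mk⇔; Equivalence)
open import Level using (0ℓ)
open import Relation.Binary.PropositionalEquality hiding ([_])
open import Relation.Nullary.Decidable using (Dec; yes; no; does; decidable-stable; _×-dec_; _⊎-dec_; _→-dec_; ¬?)
open import Relation.Nullary.Negation using (¬_; contradiction)
open import Relation.Unary as U using (Pred; Decidable)
open import Relation.Unary.Properties as U using ()

open import Algebra.Properties.CommutativeSemigroup +-commutativeSemigroup using (interchange)

-- Counting the subsets that satisfy a decidable property.

variable
  n : ℕ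
  P Q : Pred (Subset n) 0ℓ

-- Recursion on the first coordinate splits the cube into two halves, so counting identities follow
-- by induction along the vector, with no list of all subsets.
count : {P : Pred (Subset n) 0ℓ} → Decidable P → ℕ
count {zero}  P? = if does (P? []) then 1 else 0
count {suc n} P? = count (P? ∘ (outside ∷_)) + count (P? ∘ (inside ∷_))

count-none : (P? : Decidable {A = Subset n} P) → (∀ X → ¬ P X) → count P? ≡ 0
count-none {zero} P? ¬P with P? []
... | yes p = contradiction p (¬P [])
... | no  _ = refl
count-none {suc n} P? ¬P =
  cong₂ _+_ (count-none (P? ∘ (outside ∷_)) (¬P ∘ (outside ∷_)))
            (count-none (P? ∘ (inside ∷_)) (¬P ∘ (inside ∷_)))

count-pos : (P? : Decidable {A = Subset n} P) → ∀ X → P X → 0 < count P?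
count-pos P? [] p with P? []
... | yes _ = z<s
... | no ¬p = contradiction p ¬p
count-pos P? (outside ∷ X) p = ≤-trans (count-pos (P? ∘ (outside ∷_)) X p) (m≤m+n _ _)
count-pos P? (inside ∷ X) p = ≤-trans (count-pos (P? ∘ (inside ∷_)) X p) (m≤n+m _ _)

count-mono : (P? : Decidable {A = Subset n} P) (Q? : Decidable {A = Subset n} Q) →
  (∀ X → P X → Q X) → count P? ≤ count Q?
count-mono {zero} P? Q? P⊆Q with P? [] | Q? []
... | yes p | yes _ = ≤-refl
... | yes p | no ¬q = contradiction (P⊆Q [] p) ¬q
... | no _  | _     = z≤n
count-mono {suc n} P? Q? P⊆Q =
  +-mono-≤ (count-mono (P? ∘ (outside ∷_)) (Q? ∘ (outside ∷_)) (P⊆Q ∘ (outside ∷_)))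
           (count-mono (P? ∘ (inside ∷_)) (Q? ∘ (inside ∷_)) (P⊆Q ∘ (inside ∷_)))

count-cong : (P? : Decidable {A = Subset n} P) (Q? : Decidable {A = Subset n} Q) →
  (∀ X → P X → Q X) → (∀ X → Q X → P X) → count P? ≡ count Q?
count-cong P? Q? P⊆Q Q⊆P = ≤-antisym (count-mono P? Q? P⊆Q) (count-mono Q? P? Q⊆P)

-- Inclusion-exclusion in additive form, which avoids truncated subtraction. On the empty ground set
-- it is a check of four cases; `interchange` then regroups the two halves.
count-∪-∩ : (P? : Decidable {A = Subset n} P) (Q? : Decidable {A = Subset n} Q) →
  count (P? U.∪? Q?) + count (P? U.∩? Q?) ≡ count P? + count Q?
count-∪-∩ {zero} P? Q? with P? [] | Q? []
... | yes _ | yes _ = refl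
... | yes _ | no _  = refl
... | no _  | yes _ = refl
... | no _  | no _  = refl
count-∪-∩ {suc n} P? Q? = begin
  _ ≡⟨ interchange (count ((P? U.∪? Q?) ∘ (outside ∷_))) _ _ _ ⟩
  _ ≡⟨ cong₂ _+_ (count-∪-∩ (P? ∘ (outside ∷_)) (Q? ∘ (outside ∷_)))
                 (count-∪-∩ (P? ∘ (inside ∷_)) (Q? ∘ (inside ∷_))) ⟩
  _ ≡⟨ interchange (count (P? ∘ (outside ∷_))) _ _ _ ⟩
  _ ∎
  where open ≡-Reasoning

count-∪-≤ : (P? : Decidable {A = Subset n} P) (Q? : Decidable {A = Subset n} Q) →
  count (P? U.∪? Q?) ≤ count P? + count Q?
count-∪-≤ P? Q? = ≤-trans (m≤m+n _ _) (≤-reflexive (count-∪-∩ P? Q?))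

count-∪-disjoint : (P? : Decidable {A = Subset n} P) (Q? : Decidable {A = Subset n} Q) →
  (∀ X → P X → ¬ Q X) → count (P? U.∪? Q?) ≡ count P? + count Q?
count-∪-disjoint P? Q? P∩Q=∅ = begin
  count (P? U.∪? Q?)                      ≡⟨ +-identityʳ _ ⟨
  count (P? U.∪? Q?) + 0                  ≡⟨ cong (count (P? U.∪? Q?) +_)
                                              (count-none (P? U.∩? Q?) (λ X (p , q) → P∩Q=∅ X p q)) ⟨
  count (P? U.∪? Q?) + count (P? U.∩? Q?) ≡⟨ count-∪-∩ P? Q? ⟩
  count P? + count Q?                     ∎
  where open ≡-Reasoning

-- A set with `Q` but not `P` would be counted by `R?`, making the count for `Q` strictly larger.
-- This later turns equality of sizes into equality of families.
count-≡⇒⊇ : (P? : Decidable {A = Subset n} P) (Q? : Decidable {A = Subset n} Q) →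
  (∀ X → P X → Q X) → count P? ≡ count Q? → ∀ X → Q X → P X
count-≡⇒⊇ P? Q? P⊆Q eq X q = decidable-stable (P? X) λ ¬p →
  <⇒≢ (begin-strict
    count P?              <⟨ m<m+n (count P?) (count-pos R? X (¬p , q)) ⟩
    count P? + count R?   ≡⟨ count-∪-disjoint P? R? (λ _ p (¬p , _) → ¬p p) ⟨
    count (P? U.∪? R?)    ≤⟨ count-mono (P? U.∪? R?) Q? (λ X → [ P⊆Q X , proj₂ ]) ⟩
    count Q?              ∎) eq
  where
  open ≤-Reasoning
  R? = U.∁? P? U.∩? Q?

-- From lists without repetition to counts.

_≟ˢ_ : (X Y : Subset n) → Dec (X ≡ Y)
_≟ˢ_ = ≡-dec Bool._≟_

count-≟ : (X : Subset n) → count (_≟ˢ X) ≡ 1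
count-≟ []            = refl
count-≟ (outside ∷ X) = cong₂ _+_
  (trans (count-cong ((_≟ˢ (outside ∷ X)) ∘ (outside ∷_)) (_≟ˢ X) (λ { _ refl → refl }) (λ { _ refl → refl })) (count-≟ X))
  (count-none ((_≟ˢ (outside ∷ X)) ∘ (inside ∷_)) λ _ ())
count-≟ (inside ∷ X) = cong₂ _+_
  (count-none ((_≟ˢ (inside ∷ X)) ∘ (outside ∷_)) λ _ ())
  (trans (count-cong ((_≟ˢ (inside ∷ X)) ∘ (inside ∷_)) (_≟ˢ X) (λ { _ refl → refl }) (λ { _ refl → refl })) (count-≟ X))

module _ {n : ℕ} where
  open DecMembership (_≟ˢ_ {n}) public using () renaming (_∈?_ to _∈ˡ?_)

-- Uniqueness enters here: the head does not occur in the tail, so the two counts add.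
count-members : ∀ {n} (xs : List (Subset n)) → Unique xs → count (_∈ˡ? xs) ≡ length xs
count-members {n} [] _ = count-none {n} (_∈ˡ? []) λ _ ()
count-members (x ∷ xs) (x∉xs ∷ xs!) = begin
  count (_∈ˡ? (x ∷ xs))
    ≡⟨ count-cong (_∈ˡ? (x ∷ xs)) ((_≟ˢ x) U.∪? (_∈ˡ? xs)) (λ _ → Any.toSum) (λ _ → Any.fromSum) ⟩
  count ((_≟ˢ x) U.∪? (_∈ˡ? xs))
    ≡⟨ count-∪-disjoint (_≟ˢ x) (_∈ˡ? xs) (λ { _ refl x∈xs → All.lookup x∉xs x∈xs refl }) ⟩
  count (_≟ˢ x) + count (_∈ˡ? xs)
    ≡⟨ cong₂ _+_ (count-≟ x) (count-members xs xs!) ⟩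
  suc (length xs) ∎
  where open ≡-Reasoning

_∈?ᶠ_ : (X : Subset n) (F : Family n) → Dec (X ∈ᶠ F)
X ∈?ᶠ F = X ∈ˡ? members F

count-family : (F : Family n) → count (_∈?ᶠ F) ≡ ∣ F ∣ᶠ
count-family F = count-members (members F) (unique F)

-- Intervals, layers and stars of the Boolean lattice.

nC0≡1 : ∀ n → n C 0 ≡ 1
nC0≡1 n = trans (nCk≡nC[n∸k] {0} {n} z≤n) (nCn≡1 n)

-- A level of the interval from `A` to `B`, at height `j` above `A`. Layers, stars, sets of given
-- size through two points and sets of given size disjoint from `A` are all of this form, so one
-- count serves them all.
Between : (A B : Subset n) → ℕ → Pred (Subset n) 0ℓ
Between A B j X = A ⊆ X × X ⊆ B × ∣ X ∣ ≡ ∣ A ∣ + j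

between? : (A B : Subset n) (j : ℕ) → Decidable (Between A B j)
between? A B j X = (A ⊆? X) ×-dec (X ⊆? B) ×-dec (∣ X ∣ ≟ ∣ A ∣ + j)

-- X ↦ X ∖ A identifies these sets with the j-element subsets of B ∖ A.
count-between : (A B : Subset n) → A ⊆ B → ∀ j → count (between? A B j) ≡ (∣ B ∣ ∸ ∣ A ∣) C j
count-between [] [] A⊆B zero    = refl
count-between [] [] A⊆B (suc j) = sym (k>n⇒nCk≡0 {0} {suc j} z<s)
count-between (outside ∷ A) (outside ∷ B) A⊆B j = begin
  count (between? (outside ∷ A) (outside ∷ B) j)
    ≡⟨ cong₂ _+_
         (count-cong (between? (outside ∷ A) (outside ∷ B) j ∘ (outside ∷_)) (between? A B j)
           (λ _ (A⊆X , X⊆B , e) → drop-∷-⊆ A⊆X , drop-∷-⊆ X⊆B , e)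
           (λ _ (A⊆X , X⊆B , e) → out⊆ A⊆X , out⊆ X⊆B , e))
         (count-none (between? (outside ∷ A) (outside ∷ B) j ∘ (inside ∷_))
           λ _ (_ , X⊆B , _) → case X⊆B here of λ ()) ⟩
  count (between? A B j) + 0 ≡⟨ +-identityʳ _ ⟩
  count (between? A B j)     ≡⟨ count-between A B (drop-∷-⊆ A⊆B) j ⟩
  (∣ B ∣ ∸ ∣ A ∣) C j        ∎
  where open ≡-Reasoning
count-between (inside ∷ A) (outside ∷ B) A⊆B j = case A⊆B here of λ ()
count-between (inside ∷ A) (inside ∷ B) A⊆B j = begin
  count (between? (inside ∷ A) (inside ∷ B) j)
    ≡⟨ cong₂ _+_
         (count-none (between? (inside ∷ A) (inside ∷ B) j ∘ (outside ∷_))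
           λ _ (A⊆X , _ , _) → case A⊆X here of λ ())
         (count-cong (between? (inside ∷ A) (inside ∷ B) j ∘ (inside ∷_)) (between? A B j)
           (λ _ (A⊆X , X⊆B , e) → drop-∷-⊆ A⊆X , drop-∷-⊆ X⊆B , suc-injective e)
           (λ _ (A⊆X , X⊆B , e) → in⊆in A⊆X , in⊆in X⊆B , cong suc e)) ⟩
  count (between? A B j) ≡⟨ count-between A B (drop-∷-⊆ A⊆B) j ⟩
  (∣ B ∣ ∸ ∣ A ∣) C j    ∎
  where open ≡-Reasoning
-- The first element lies in `B` but not in `A`: the sets omitting it and the sets containing it
-- give the two terms of Pascal's rule.
count-between (outside ∷ A) (inside ∷ B) A⊆B j = begin
  count (between? (outside ∷ A) (inside ∷ B) j)
    ≡⟨ cong (_+ count (between? (outside ∷ A) (inside ∷ B) j ∘ (inside ∷_)))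
         (count-cong (between? (outside ∷ A) (inside ∷ B) j ∘ (outside ∷_)) (between? A B j)
           (λ _ (A⊆X , X⊆B , e) → drop-∷-⊆ A⊆X , drop-∷-⊆ X⊆B , e)
           (λ _ (A⊆X , X⊆B , e) → out⊆ A⊆X , out⊆ X⊆B , e)) ⟩
  count (between? A B j) + count (between? (outside ∷ A) (inside ∷ B) j ∘ (inside ∷_))
    ≡⟨ cong (_+ count (between? (outside ∷ A) (inside ∷ B) j ∘ (inside ∷_)))
         (count-between A B A⊆B′ j) ⟩
  d C j + count (between? (outside ∷ A) (inside ∷ B) j ∘ (inside ∷_))
    ≡⟨ pascal j ⟩
  suc d C j
    ≡⟨ cong (_C j) (+-∸-assoc 1 (p⊆q⇒∣p∣≤∣q∣ A⊆B′)) ⟨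
  (suc ∣ B ∣ ∸ ∣ A ∣) C j ∎
  where
  open ≡-Reasoning
  A⊆B′ : A ⊆ B
  A⊆B′ = drop-∷-⊆ A⊆B
  d = ∣ B ∣ ∸ ∣ A ∣
  pascal : ∀ j → d C j + count (between? (outside ∷ A) (inside ∷ B) j ∘ (inside ∷_)) ≡ suc d C j
  -- At height 0 no set can contain the extra element, since it would have more than `∣ A ∣`
  -- elements.
  pascal zero = begin
    d C 0 + count (between? (outside ∷ A) (inside ∷ B) 0 ∘ (inside ∷_))
      ≡⟨ cong₂ _+_ (nC0≡1 d)
           (count-none (between? (outside ∷ A) (inside ∷ B) 0 ∘ (inside ∷_)) λ _ (A⊆X , _ , e) →
             <-irrefl (trans (sym (+-identityʳ ∣ A ∣)) (sym e)) (s≤s (p⊆q⇒∣p∣≤∣q∣ (drop-∷-⊆ A⊆X)))) ⟩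
    1         ≡⟨ nC0≡1 (suc d) ⟨
    suc d C 0 ∎
  pascal (suc j) = begin
    d C suc j + count (between? (outside ∷ A) (inside ∷ B) (suc j) ∘ (inside ∷_))
      ≡⟨ cong (d C suc j +_)
           (count-cong (between? (outside ∷ A) (inside ∷ B) (suc j) ∘ (inside ∷_)) (between? A B j)
             (λ _ (A⊆X , X⊆B , e) → drop-∷-⊆ A⊆X , drop-∷-⊆ X⊆B , suc-injective (trans e (+-suc ∣ A ∣ j)))
             (λ _ (A⊆X , X⊆B , e) → out⊆ A⊆X , in⊆in X⊆B , trans (cong suc e) (sym (+-suc ∣ A ∣ j)))) ⟩
    d C suc j + count (between? A B j) ≡⟨ cong (d C suc j +_) (count-between A B A⊆B′ j) ⟩
    d C suc j + d C j                  ≡⟨ +-comm (d C suc j) (d C j) ⟩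
    d C j + d C suc j                  ≡⟨ nCk+nC[k+1]≡[n+1]C[k+1] d j ⟩
    suc d C suc j                      ∎

count-layer : ∀ n k → count {n} (λ X → ∣ X ∣ ≟ k) ≡ n C k
count-layer n k = begin
  count {n} (λ X → ∣ X ∣ ≟ k)
    ≡⟨ count-cong {n} (λ X → ∣ X ∣ ≟ k) (between? ⊥ ⊤ k)
         (λ _ e → ⊥⊆ , ⊆⊤ , trans e (cong (_+ k) (sym (∣⊥∣≡0 n))))
         (λ _ (_ , _ , e) → trans e (cong (_+ k) (∣⊥∣≡0 n))) ⟩
  count (between? {n} ⊥ ⊤ k)       ≡⟨ count-between {n} ⊥ ⊤ ⊥⊆ k ⟩
  (∣ ⊤ {n} ∣ ∸ ∣ ⊥ {n} ∣) C k  ≡⟨ cong₂ (λ a b → (a ∸ b) C k) (∣⊤∣≡n n) (∣⊥∣≡0 n) ⟩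
  n C k                        ∎
  where open ≡-Reasoning

-- The half-open range lets induction on `m` peel off the bottom layer. Since `applyUpTo` recurses
-- through `f ∘ suc`, the summand is a general `f` specified pointwise.
count-layers : ∀ n a m (f : ℕ → ℕ) → (∀ i → f i ≡ n C (a + i)) →
  count {n} (λ X → (a ≤? ∣ X ∣) ×-dec (∣ X ∣ <? a + m)) ≡ sum (applyUpTo f m)
count-layers n a zero f f≗ = count-none {n} (λ X → (a ≤? ∣ X ∣) ×-dec (∣ X ∣ <? a + 0))
  λ _ (a≤ , <a) → <-irrefl refl (<-≤-trans <a (≤-trans (≤-reflexive (+-identityʳ a)) a≤))
count-layers n a (suc m) f f≗ = begin
  count {n} (λ X → (a ≤? ∣ X ∣) ×-dec (∣ X ∣ <? a + suc m))
    ≡⟨ count-cong (λ X → (a ≤? ∣ X ∣) ×-dec (∣ X ∣ <? a + suc m)) (bottom? U.∪? rest?)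
         (λ X (a≤ , <b) → case a ≟ ∣ X ∣ of λ
           { (yes e) → inj₁ (sym e)
           ; (no ne) → inj₂ (≤∧≢⇒< a≤ ne , <-≤-trans <b (≤-reflexive (+-suc a m))) })
         (λ X → λ
           { (inj₁ e) → ≤-reflexive (sym e) , ≤-trans (s≤s (≤-trans (≤-reflexive e) (m≤m+n a m))) (≤-reflexive (sym (+-suc a m)))
           ; (inj₂ (a< , <b)) → <⇒≤ a< , <-≤-trans <b (≤-reflexive (sym (+-suc a m))) }) ⟩
  count (bottom? U.∪? rest?)
    ≡⟨ count-∪-disjoint bottom? rest? (λ _ e (a< , _) → <⇒≢ a< (sym e)) ⟩
  count bottom? + count rest?
    ≡⟨ cong₂ _+_ (trans (count-layer n a) (sym (trans (f≗ 0) (cong (n C_) (+-identityʳ a)))))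
         (count-layers n (suc a) m (f ∘ suc) (λ i → trans (f≗ (suc i)) (cong (n C_) (+-suc a i)))) ⟩
  f 0 + sum (applyUpTo (f ∘ suc) m) ∎
  where
  open ≡-Reasoning
  bottom? : Decidable {A = Subset n} λ X → ∣ X ∣ ≡ a
  bottom? X = ∣ X ∣ ≟ a
  rest? : Decidable {A = Subset n} λ X → suc a ≤ ∣ X ∣ × ∣ X ∣ < suc a + m
  rest? X = (suc a ≤? ∣ X ∣) ×-dec (∣ X ∣ <? suc a + m)

SizeIn : (a u : ℕ) → Pred (Subset n) 0ℓ
SizeIn a u X = a ≤ ∣ X ∣ × ∣ X ∣ ≤ u

sizeIn? : (a u : ℕ) → Decidable (SizeIn {n} a u)
sizeIn? a u X = (a ≤? ∣ X ∣) ×-dec (∣ X ∣ ≤? u)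

count-sizeIn : ∀ n a u → a ≤ suc u → count (sizeIn? {n} a u) ≡ ∑[ a ⋯ u ] (n C_)
count-sizeIn n a u a≤1+u = trans
  (count-cong {n} (sizeIn? a u) (λ X → (a ≤? ∣ X ∣) ×-dec (∣ X ∣ <? a + (suc u ∸ a)))
    (λ _ (a≤ , ≤u) → a≤ , ≤-trans (s≤s ≤u) (≤-reflexive (sym (m+[n∸m]≡n a≤1+u))))
    (λ _ (a≤ , <b) → a≤ , s≤s⁻¹ (≤-trans <b (≤-reflexive (m+[n∸m]≡n a≤1+u)))))
  (count-layers n a (suc u ∸ a) (λ i → n C (a + i)) (λ _ → refl))

count-star : (x : Fin n) (j : ℕ) →
  count (λ X → (∣ X ∣ ≟ suc j) ×-dec (x ∈? X)) ≡ (n ∸ 1) C j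
count-star {n} x j = begin
  count (λ X → (∣ X ∣ ≟ suc j) ×-dec (x ∈? X))
    ≡⟨ count-cong (λ X → (∣ X ∣ ≟ suc j) ×-dec (x ∈? X)) (between? ⁅ x ⁆ ⊤ j)
         (λ X (e , x∈X) → (λ y∈ → subst (_∈ X) (sym (x∈⁅y⁆⇒x≡y x y∈)) x∈X) , ⊆⊤ , trans e (cong (_+ j) (sym (∣⁅x⁆∣≡1 x))))
         (λ _ (x⊆ , _ , e) → trans e (cong (_+ j) (∣⁅x⁆∣≡1 x)) , x⊆ (x∈⁅x⁆ x)) ⟩
  count (between? ⁅ x ⁆ ⊤ j)  ≡⟨ count-between ⁅ x ⁆ ⊤ ⊆⊤ j ⟩
  (∣ ⊤ {n} ∣ ∸ ∣ ⁅ x ⁆ ∣) C j ≡⟨ cong₂ (λ a b → (a ∸ b) C j) (∣⊤∣≡n n) (∣⁅x⁆∣≡1 x) ⟩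
  (n ∸ 1) C j                 ∎
  where open ≡-Reasoning

∣⁅x⁆∪⁅y⁆∣≡2 : (x y : Fin n) → x ≢ y → ∣ ⁅ x ⁆ ∪ ⁅ y ⁆ ∣ ≡ 2
∣⁅x⁆∪⁅y⁆∣≡2 zero    zero    x≢y = contradiction refl x≢y
∣⁅x⁆∪⁅y⁆∣≡2 zero    (suc y) x≢y = cong suc (trans (cong ∣_∣ (∪-identityˡ ⁅ y ⁆)) (∣⁅x⁆∣≡1 y))
∣⁅x⁆∪⁅y⁆∣≡2 (suc x) zero    x≢y = cong suc (trans (cong ∣_∣ (∪-identityʳ ⁅ x ⁆)) (∣⁅x⁆∣≡1 x))
∣⁅x⁆∪⁅y⁆∣≡2 (suc x) (suc y) x≢y = ∣⁅x⁆∪⁅y⁆∣≡2 x y (x≢y ∘ cong suc)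

count-pair : (P? : Decidable {A = Subset n} P) (x y : Fin n) (j : ℕ) → x ≢ y →
  (∀ X → P X → ∣ X ∣ ≡ suc (suc j) × x ∈ X × y ∈ X) → count P? ≤ (n ∸ 2) C j
count-pair {n} P? x y j x≢y P⊆ = begin
  count P?
    ≤⟨ count-mono P? (between? (⁅ x ⁆ ∪ ⁅ y ⁆) ⊤ j) (λ X p → let (e , x∈X , y∈X) = P⊆ X p in
         (λ z∈ → [ (λ z∈x → subst (_∈ X) (sym (x∈⁅y⁆⇒x≡y x z∈x)) x∈X)
                 , (λ z∈y → subst (_∈ X) (sym (x∈⁅y⁆⇒x≡y y z∈y)) y∈X) ] (x∈p∪q⁻ ⁅ x ⁆ ⁅ y ⁆ z∈))
         , ⊆⊤ , trans e (cong (_+ j) (sym (∣⁅x⁆∪⁅y⁆∣≡2 x y x≢y)))) ⟩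
  count (between? (⁅ x ⁆ ∪ ⁅ y ⁆) ⊤ j)
    ≡⟨ count-between (⁅ x ⁆ ∪ ⁅ y ⁆) ⊤ ⊆⊤ j ⟩
  (∣ ⊤ {n} ∣ ∸ ∣ ⁅ x ⁆ ∪ ⁅ y ⁆ ∣) C j
    ≡⟨ cong₂ (λ a b → (a ∸ b) C j) (∣⊤∣≡n n) (∣⁅x⁆∪⁅y⁆∣≡2 x y x≢y) ⟩
  (n ∸ 2) C j ∎
  where open ≤-Reasoning

-- Splitting on the first element, the inductive bounds (n + 1)^(m + 1) and (n + 1)^m add up to (n +
-- 2)(n + 1)^m. Crude, but the exponent is what matters for large n.
count-small : ∀ n m → count {n} (λ X → ∣ X ∣ <? suc m) ≤ suc n ^ m
count-small zero    m       = ≤-reflexive (sym (^-zeroˡ m))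
count-small (suc n) zero    = begin
  count {suc n} (λ X → ∣ X ∣ <? 1)
    ≡⟨ cong (count {n} (λ X → ∣ X ∣ <? 1) +_) (count-none {n} (λ X → suc ∣ X ∣ <? 1) λ { _ (s≤s ()) }) ⟩
  count {n} (λ X → ∣ X ∣ <? 1) + 0 ≡⟨ +-identityʳ _ ⟩
  count {n} (λ X → ∣ X ∣ <? 1)     ≤⟨ count-small n zero ⟩
  1                                ∎
  where open ≤-Reasoning
count-small (suc n) (suc m) = begin
  count {n} (λ X → ∣ X ∣ <? suc (suc m)) + count {n} (λ X → suc ∣ X ∣ <? suc (suc m))
    ≤⟨ +-mono-≤ (count-small n (suc m))
         (≤-trans (count-mono {n} (λ X → suc ∣ X ∣ <? suc (suc m)) (λ X → ∣ X ∣ <? suc m) (λ _ → s≤s⁻¹))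
                  (count-small n m)) ⟩
  suc n * suc n ^ m + suc n ^ m  ≡⟨ +-comm (suc n * suc n ^ m) (suc n ^ m) ⟩
  suc (suc n) * suc n ^ m        ≤⟨ *-monoʳ-≤ (suc (suc n)) (^-monoˡ-≤ m (n≤1+n (suc n))) ⟩
  suc (suc n) * suc (suc n) ^ m  ∎
  where open ≤-Reasoning

-- Estimates for binomial coefficients.

C-monoˡ-+ : ∀ q b m → b C m ≤ (q + b) C m
C-monoˡ-+ zero    b m       = ≤-refl
C-monoˡ-+ (suc q) b zero    = ≤-reflexive (trans (nC0≡1 b) (sym (nC0≡1 (suc q + b))))
C-monoˡ-+ (suc q) b (suc m) = begin
  b C suc m                         ≤⟨ C-monoˡ-+ q b (suc m) ⟩
  (q + b) C suc m                   ≤⟨ m≤n+m _ _ ⟩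
  (q + b) C m + (q + b) C suc m     ≡⟨ nCk+nC[k+1]≡[n+1]C[k+1] (q + b) m ⟩
  suc (q + b) C suc m               ∎
  where open ≤-Reasoning

C-monoˡ : ∀ {a b} m → a ≤ b → a C m ≤ b C m
C-monoˡ {a} {b} m a≤b = ≤-trans (C-monoˡ-+ (b ∸ a) a m) (≤-reflexive (cong (_C m) (m∸n+n≡m a≤b)))

-- Choose one element among the first q and m among the other b.
q*bCm≤[q+b]C[1+m] : ∀ q b m → q * (b C m) ≤ (q + b) C suc m
q*bCm≤[q+b]C[1+m] zero    b m = z≤n
q*bCm≤[q+b]C[1+m] (suc q) b m = begin
  b C m + q * (b C m)           ≤⟨ +-mono-≤ (C-monoˡ-+ q b m) (q*bCm≤[q+b]C[1+m] q b m) ⟩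
  (q + b) C m + (q + b) C suc m ≡⟨ nCk+nC[k+1]≡[n+1]C[k+1] (q + b) m ⟩
  suc (q + b) C suc m           ∎
  where open ≤-Reasoning

-- Cut the ground set into m blocks of size q; choosing one element from each block gives q^m
-- different m-sets.
q^m≤[m*q]Cm : ∀ q m → q ^ m ≤ (m * q) C m
q^m≤[m*q]Cm q zero    = ≤-reflexive (sym (nC0≡1 0))
q^m≤[m*q]Cm q (suc m) = ≤-trans (*-monoʳ-≤ q (q^m≤[m*q]Cm q m)) (q*bCm≤[q+b]C[1+m] q (m * q) m)

-- Both sides count (k + 1)-sets with a marked element. The induction goes through Pascal's rule and
-- so avoids division.
absorption : ∀ n k → suc k * (suc n C suc k) ≡ suc n * (n C k)
absorption zero    zero    = refl
absorption zero    (suc k) = trans (cong (suc (suc k) *_) (k>n⇒nCk≡0 {1} {suc (suc k)} (s≤s (s≤s z≤n))))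
  (trans (*-zeroʳ (suc (suc k))) (sym (cong (1 *_) (k>n⇒nCk≡0 {0} {suc k} z<s))))
absorption (suc n) zero    = begin
  1 * (suc (suc n) C 1)               ≡⟨ cong (1 *_) (nCk+nC[k+1]≡[n+1]C[k+1] (suc n) 0) ⟨
  1 * (suc n C 0 + suc n C 1)         ≡⟨ *-distribˡ-+ 1 (suc n C 0) (suc n C 1) ⟩
  1 * (suc n C 0) + 1 * (suc n C 1)   ≡⟨ cong₂ _+_ (*-identityˡ (suc n C 0)) (absorption n 0) ⟩
  suc n C 0 + suc n * (n C 0)         ≡⟨ cong (λ t → suc n C 0 + suc n * t) (trans (nC0≡1 n) (sym (nC0≡1 (suc n)))) ⟩
  suc (suc n) * (suc n C 0)           ∎
  where open ≡-Reasoning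
absorption (suc n) (suc k) = begin
  suc (suc k) * (suc (suc n) C suc (suc k))
    ≡⟨ cong (suc (suc k) *_) (nCk+nC[k+1]≡[n+1]C[k+1] (suc n) (suc k)) ⟨
  suc (suc k) * (c + suc n C suc (suc k))
    ≡⟨ *-distribˡ-+ (suc (suc k)) c _ ⟩
  (c + suc k * c) + suc (suc k) * (suc n C suc (suc k))
    ≡⟨ cong₂ (λ a b → (c + a) + b) (absorption n k) (absorption n (suc k)) ⟩
  (c + suc n * (n C k)) + suc n * (n C suc k)
    ≡⟨ +-assoc c _ _ ⟩
  c + (suc n * (n C k) + suc n * (n C suc k))
    ≡⟨ cong (c +_) (*-distribˡ-+ (suc n) (n C k) (n C suc k)) ⟨
  c + suc n * (n C k + n C suc k)
    ≡⟨ cong (λ t → c + suc n * t) (nCk+nC[k+1]≡[n+1]C[k+1] n k) ⟩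
  suc (suc n) * c ∎
  where
  open ≡-Reasoning
  c = suc n C suc k

^-distribʳ-* : ∀ a b m → (a * b) ^ m ≡ a ^ m * b ^ m
^-distribʳ-* a b zero    = refl
^-distribʳ-* a b (suc m) = trans (cong (a * b *_) (^-distribʳ-* a b m)) ([m*n]*[o*p]≡[m*o]*[n*p] a b (a ^ m) (b ^ m))

-- Makes the quotient q of n by m + 1 satisfy both q ≥ m, which leaves room for fewer than m further
-- elements beside m blocks of size q, and q > (2 (m + 1))^(m - 1), which makes q^m exceed (n +
-- 1)^(m - 1).
threshold : ℕ → ℕ
threshold m = (m + suc ((2 * suc m) ^ pred m)) * suc m

-- With q = ⌊n / (m + 1)⌋ the right-hand side is at least q ^ m, while n + 1 ≤ 2 (m + 1) q.
small<disjoint : ∀ {n a m} → threshold (suc m) ≤ n → a < suc m → suc n ^ m < (n ∸ a) C suc m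
small<disjoint {n} {a} {m} N≤n a<1+m = begin-strict
  suc n ^ m                    ≤⟨ ^-monoˡ-≤ m 1+n≤q*c ⟩
  (q * c) ^ m                  ≡⟨ ^-distribʳ-* q c m ⟩
  q ^ m * c ^ m                <⟨ *-monoʳ-< (q ^ m) {{m^n≢0 q m}} c^m<q ⟩
  q ^ m * q                    ≡⟨ *-comm (q ^ m) q ⟩
  q ^ suc m                    ≤⟨ q^m≤[m*q]Cm q (suc m) ⟩
  (suc m * q) C suc m          ≤⟨ C-monoˡ (suc m) (m+n≤o⇒m≤o∸n (suc m * q) mq+a≤n) ⟩
  (n ∸ a) C suc m              ∎
  where
  open ≤-Reasoning
  c = 2 * suc (suc m)
  q = n / suc (suc m)
  T≤q : suc m + suc (c ^ m) ≤ q
  T≤q = ≤-trans (≤-reflexive (sym (m*n/n≡m (suc m + suc (c ^ m)) (suc (suc m))))) (/-monoˡ-≤ (suc (suc m)) N≤n)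
  c^m<q : c ^ m < q
  c^m<q = ≤-trans (m≤n+m _ (suc m)) T≤q
  instance
    q≢0 : NonZero q
    q≢0 = >-nonZero (≤-<-trans z≤n c^m<q)
  mq+a≤n : suc m * q + a ≤ n
  mq+a≤n = begin
    suc m * q + a       ≤⟨ +-monoʳ-≤ (suc m * q) (≤-trans (<⇒≤ a<1+m) (≤-trans (m≤m+n _ _) T≤q)) ⟩
    suc m * q + q       ≡⟨ +-comm (suc m * q) q ⟩
    suc (suc m) * q     ≡⟨ *-comm (suc (suc m)) q ⟩
    q * suc (suc m)     ≤⟨ m/n*n≤m n (suc (suc m)) ⟩
    n                   ∎
  1+n≤q*c : suc n ≤ q * c
  1+n≤q*c = begin
    -- The remainder plus one is at most m + 2, hence at most one more q (m + 2); this doubling is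
    -- the factor 2 in `c`.
    suc n                               ≡⟨ cong suc (m≡m%n+[m/n]*n n (suc (suc m))) ⟩
    suc (n % suc (suc m)) + q * suc (suc m) ≤⟨ +-monoˡ-≤ (q * suc (suc m)) (m%n<n n (suc (suc m))) ⟩
    suc (suc m) + q * suc (suc m)       ≤⟨ +-monoˡ-≤ _ (m≤n*m (suc (suc m)) q) ⟩
    q * suc (suc m) + q * suc (suc m)   ≡⟨ *-distribˡ-+ q (suc (suc m)) (suc (suc m)) ⟨
    q * (suc (suc m) + suc (suc m))     ≡⟨ cong (λ t → q * (suc (suc m) + t)) (+-identityʳ (suc (suc m))) ⟨
    q * c                               ∎

-- The cost of a small member.

∣p∪q∣≤∣p∣+∣q∣ : (p q : Subset n) → ∣ p ∪ q ∣ ≤ ∣ p ∣ + ∣ q ∣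
∣p∪q∣≤∣p∣+∣q∣ []            []            = z≤n
∣p∪q∣≤∣p∣+∣q∣ (outside ∷ p) (outside ∷ q) = ∣p∪q∣≤∣p∣+∣q∣ p q
∣p∪q∣≤∣p∣+∣q∣ (outside ∷ p) (inside ∷ q)  = ≤-trans (s≤s (∣p∪q∣≤∣p∣+∣q∣ p q)) (≤-reflexive (sym (+-suc ∣ p ∣ ∣ q ∣)))
∣p∪q∣≤∣p∣+∣q∣ (inside ∷ p)  (outside ∷ q) = s≤s (∣p∪q∣≤∣p∣+∣q∣ p q)
∣p∪q∣≤∣p∣+∣q∣ (inside ∷ p)  (inside ∷ q)  = s≤s (≤-trans (∣p∪q∣≤∣p∣+∣q∣ p q) (+-monoʳ-≤ ∣ p ∣ (n≤1+n ∣ q ∣)))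

-- An exchange: drop the members of size at most m and add all (m + 1)-sets disjoint from `A`. These
-- are not members, by the last hypothesis, and they outnumber what was dropped, yet the result
-- stays within sizes m + 1 to u. It is applied with m + 1 = k for odd s and m + 1 = k + 1 for even
-- s.
small-member⇒small-family : ∀ {m u} (F : Family n) → threshold (suc m) ≤ n → suc m ≤ u → F ⊆[≤ u ] →
  ∀ {A} → A ∈ᶠ F → ∣ A ∣ < suc m → (∀ {B} → B ∈ᶠ F → ∣ B ∣ ≡ suc m → Nonempty (A ∩ B)) →
  ∣ F ∣ᶠ < count (sizeIn? {n} (suc m) u)
small-member⇒small-family {n} {m} {u} F N≤n m<u F≤u {A} A∈F ∣A∣<1+m A-meets = begin-strict
  ∣ F ∣ᶠ
    ≡⟨ count-family F ⟨
  count (_∈?ᶠ F)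
    ≤⟨ count-mono (_∈?ᶠ F) (small? U.∪? large?) (λ X X∈F → case ∣ X ∣ <? suc m of λ
         { (yes <m) → inj₁ <m
         ; (no ≮m) → inj₂ (X∈F , ≮⇒≥ ≮m , F≤u X∈F) }) ⟩
  count (small? U.∪? large?)
    ≤⟨ count-∪-≤ small? large? ⟩
  count small? + count large?
    ≤⟨ +-monoˡ-≤ (count large?) (count-small n m) ⟩
  suc n ^ m + count large?
    <⟨ +-monoˡ-< (count large?) (small<disjoint N≤n ∣A∣<1+m) ⟩
  (n ∸ ∣ A ∣) C suc m + count large?
    ≡⟨ cong (_+ count large?) count-disjoint ⟨
  count disjoint? + count large?
    ≡⟨ count-∪-disjoint disjoint? large? (λ X (_ , X⊆∁A , e) (X∈F , _) →
         let (x , x∈A∩X) = A-meets X∈F (trans e (cong (_+ suc m) (∣⊥∣≡0 n)))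
             (x∈A , x∈X) = x∈p∩q⁻ A X x∈A∩X
         in x∈∁p⇒x∉p (X⊆∁A x∈X) x∈A) ⟨
  count (disjoint? U.∪? large?)
    ≤⟨ count-mono {n} (disjoint? U.∪? large?) (sizeIn? (suc m) u) (λ X → λ
         { (inj₁ (_ , _ , e)) → let ∣X∣≡ = trans e (cong (_+ suc m) (∣⊥∣≡0 n)) in
             ≤-reflexive (sym ∣X∣≡) , ≤-trans (≤-reflexive ∣X∣≡) m<u
         ; (inj₂ (_ , in-range)) → in-range }) ⟩
  count (sizeIn? {n} (suc m) u) ∎
  where
  open ≤-Reasoning
  small? : Decidable {A = Subset n} λ X → ∣ X ∣ < suc m
  small? X = ∣ X ∣ <? suc m
  large? : Decidable {A = Subset n} λ X → X ∈ᶠ F × SizeIn (suc m) u X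
  large? X = (X ∈?ᶠ F) ×-dec sizeIn? (suc m) u X
  disjoint? = between? ⊥ (∁ A) (suc m)
  count-disjoint : count disjoint? ≡ (n ∸ ∣ A ∣) C suc m
  count-disjoint = trans (count-between ⊥ (∁ A) ⊥⊆ (suc m))
    (cong₂ (λ a b → (a ∸ b) C suc m) (∣∁p∣≡n∸∣p∣ A) (∣⊥∣≡0 n))

-- Intersecting families without a common element.

count-cover : ∀ {m} (A : Subset m) {Q : Fin m → Pred (Subset n) 0ℓ} (Q? : ∀ i → Decidable (Q i))
  (P? : Decidable {A = Subset n} P) (M : ℕ) →
  (∀ X → P X → ∃ λ i → i ∈ A × Q i X) → (∀ i → i ∈ A → count (P? U.∩? Q? i) ≤ M) →
  count P? ≤ ∣ A ∣ * M
count-cover [] Q? P? M covers bounds =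
  ≤-reflexive (count-none P? (λ X p → case covers X p of λ ()))
count-cover (outside ∷ A) Q? P? M covers bounds =
  count-cover A (λ i → Q? (suc i)) P? M
    (λ X p → case covers X p of λ { (suc i , there i∈A , q) → i , i∈A , q })
    (λ i i∈A → bounds (suc i) (there i∈A))
-- A union bound: the sets with `Q zero` are split off, and the remaining ones are covered by the
-- tail of `A`. The index set has its own ground set `Fin m`, so it shrinks while the counted sets
-- stay in place.
count-cover {P = P} (inside ∷ A) {Q} Q? P? M covers bounds = begin
  count P?
    ≤⟨ count-mono P? (first? U.∪? rest?) (λ X p → case Q? zero X of λ
         { (yes q) → inj₁ (p , q) ; (no ¬q) → inj₂ (p , ¬q) }) ⟩
  count (first? U.∪? rest?)
    ≤⟨ count-∪-≤ first? rest? ⟩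
  count first? + count rest?
    ≤⟨ +-mono-≤ (bounds zero here) (count-cover A (λ i → Q? (suc i)) rest? M
         (λ X (p , ¬q) → case covers X p of λ
           { (zero , _ , q) → contradiction q ¬q
           ; (suc i , there i∈A , q) → i , i∈A , q })
         (λ i i∈A → ≤-trans
           (count-mono (rest? U.∩? Q? (suc i)) (P? U.∩? Q? (suc i)) (λ _ ((p , _) , q) → p , q))
           (bounds (suc i) (there i∈A)))) ⟩
  M + ∣ A ∣ * M ∎
  where
  open ≤-Reasoning
  first? = P? U.∩? Q? zero
  rest? = P? U.∩? U.∁? (Q? zero)

-- Every member meets a fixed member A in some a, and then meets a member avoiding a in some b ≠ a.
count-nontrivial-intersecting : ∀ {j} (P? : Decidable {A = Subset n} P) → Fin n →
  (∀ X → P X → ∣ X ∣ ≡ suc (suc j)) → (∀ X Y → P X → P Y → Nonempty (X ∩ Y)) →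
  (∀ x → ∃ λ B → P B × x ∉ B) →
  count P? ≤ suc (suc j) * (suc (suc j) * ((n ∸ 2) C j))
count-nontrivial-intersecting {n} {j = j} P? x₀ size intersecting avoiding =
  subst (λ k → count P? ≤ k * M) (size A pA) (count-cover A (λ a X → a ∈? X) P? M
    (λ X pX → let (a , a∈) = intersecting A X pA pX in a , x∈p∩q⁻ A X a∈)
    through)
  where
  M = suc (suc j) * ((n ∸ 2) C j)
  -- The point `x₀` is arbitrary; it serves to extract one member.
  A = proj₁ (avoiding x₀)
  pA = proj₁ (proj₂ (avoiding x₀))
  through : ∀ a → a ∈ A → count (P? U.∩? (a ∈?_)) ≤ M
  through a _ = subst (λ k → count (P? U.∩? (a ∈?_)) ≤ k * ((n ∸ 2) C j)) (size B pB)
    (count-cover B (λ b X → b ∈? X) (P? U.∩? (a ∈?_)) ((n ∸ 2) C j)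
      (λ X (pX , _) → let (b , b∈) = intersecting B X pB pX in b , x∈p∩q⁻ B X b∈)
      (λ b b∈B → count-pair ((P? U.∩? (a ∈?_)) U.∩? (b ∈?_)) a b j
        (λ { refl → a∉B b∈B })
        (λ X ((pX , a∈X) , b∈X) → size X pX , a∈X , b∈X)))
    where
    B = proj₁ (avoiding a)
    pB = proj₁ (proj₂ (avoiding a))
    a∉B = proj₂ (proj₂ (avoiding a))

-- By `absorption`, (j + 1) C(n - 1, j + 1) = (n - 1) C(n - 2, j). Multiplying the claim by j + 1 ≤
-- k therefore reduces it to k³ < n - 1.
k²C<C : ∀ {n j} → let k = suc (suc j) in 2 + k * k * k ≤ n →
  k * (k * ((n ∸ 2) C j)) < (n ∸ 1) C suc j
k²C<C {suc (suc n′)} {j} (s≤s (s≤s k³≤n′)) = *-cancelˡ-< (suc j) _ _ (begin-strict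
  suc j * (k * (k * c))   ≤⟨ *-monoˡ-≤ (k * (k * c)) (n≤1+n (suc j)) ⟩
  k * (k * (k * c))       ≡⟨ cong (k *_) (*-assoc k k c) ⟨
  k * (k * k * c)         ≡⟨ *-assoc k (k * k) c ⟨
  k * (k * k) * c         ≡⟨ cong (_* c) (*-assoc k k k) ⟨
  k * k * k * c           ≤⟨ *-monoˡ-≤ c k³≤n′ ⟩
  n′ * c                  <⟨ *-monoˡ-< c {{>-nonZero c>0}} (n<1+n n′) ⟩
  suc n′ * c              ≡⟨ absorption n′ j ⟨
  suc j * (suc n′ C suc j) ∎)
  where
  open ≤-Reasoning
  k = suc (suc j)
  c = n′ C j
  j≤n′ : j ≤ n′
  j≤n′ = ≤-trans (≤-trans (m≤n+m j 2) (m≤n*m k (k * k))) k³≤n′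
  -- Positivity of C(n - 2, j) is what makes the inequality strict.
  c>0 : 0 < c
  c>0 = ≤-trans (≤-reflexive (sym (nCn≡1 j))) (C-monoˡ j j≤n′)

-- Permutations of the ground set and copies of the extremal families.

open MonoidSum +-0-commutativeMonoid using (sum-permute; sum-cong-≗) renaming (sum to ∑)

-- Writing the size as a sum over the ground set turns its invariance under permutations into
-- reindexing of a finite sum.
indicator : Subset n → Fin n → ℕ
indicator X i = if lookup X i then 1 else 0

∣X∣≡∑indicator : (X : Subset n) → ∣ X ∣ ≡ ∑ (indicator X)
∣X∣≡∑indicator []            = refl
∣X∣≡∑indicator (outside ∷ X) = ∣X∣≡∑indicator X
∣X∣≡∑indicator (inside ∷ X)  = cong suc (∣X∣≡∑indicator X)

∣image∣ : (π : Permutation′ n) (X : Subset n) → ∣ image π X ∣ ≡ ∣ X ∣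
∣image∣ π X = begin
  ∣ image π X ∣                        ≡⟨ ∣X∣≡∑indicator (image π X) ⟩
  ∑ (indicator (image π X))            ≡⟨ sum-cong-≗ (λ i → cong (if_then 1 else 0)
                                            (lookup∘tabulate (λ i → lookup X (π ⟨$⟩ˡ i)) i)) ⟩
  -- `image` pulls back along the inverse of `π`, hence the `flip`.
  ∑ (λ i → indicator X (π ⟨$⟩ˡ i))     ≡⟨ sum-permute (indicator X) (flip π) ⟨
  ∑ (indicator X)                      ≡⟨ ∣X∣≡∑indicator X ⟨
  ∣ X ∣                                ∎
  where open ≡-Reasoning

∈-image⁺ : (π : Permutation′ n) (X : Subset n) (x : Fin n) → π ⟨$⟩ˡ x ∈ X → x ∈ image π X
∈-image⁺ π X x x∈ = lookup⇒[]= x (image π X) (trans (lookup∘tabulate _ x) ([]=⇒lookup x∈))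

∈-image⁻ : (π : Permutation′ n) (X : Subset n) (x : Fin n) → x ∈ image π X → π ⟨$⟩ˡ x ∈ X
∈-image⁻ π X x x∈ = lookup⇒[]= (π ⟨$⟩ˡ x) X (trans (sym (lookup∘tabulate _ x)) ([]=⇒lookup x∈))

-- The even extremal family with an arbitrary centre `x`; as `x` varies, these are all its
-- isomorphic copies.
StarOrLarge : ℕ → ℕ → Fin n → Pred (Subset n) 0ℓ
StarOrLarge k u x X = (∣ X ∣ ≡ k × x ∈ X) ⊎ SizeIn (suc k) u X

starOrLarge? : ∀ k u (x : Fin n) → Decidable (StarOrLarge k u x)
starOrLarge? k u x X = ((∣ X ∣ ≟ k) ×-dec (x ∈? X)) ⊎-dec sizeIn? (suc k) u X

count-starOrLarge : ∀ j u (x : Fin n) → let k = suc j in k ≤ u →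
  count (starOrLarge? k u x) ≡ (n ∸ 1) C (k ∸ 1) + ∑[ k + 1 ⋯ u ] (n C_)
count-starOrLarge {n} j u x k≤u = begin
  count (starOrLarge? (suc j) u x)
    ≡⟨ count-∪-disjoint (λ X → (∣ X ∣ ≟ suc j) ×-dec (x ∈? X)) (sizeIn? (suc (suc j)) u)
         (λ _ (e , _) (k<∣X∣ , _) → <⇒≢ k<∣X∣ (sym e)) ⟩
  count (λ X → (∣ X ∣ ≟ suc j) ×-dec (x ∈? X)) + count (sizeIn? {n} (suc (suc j)) u)
    ≡⟨ cong₂ _+_ (count-star x j) (count-sizeIn n (suc (suc j)) u (s≤s k≤u)) ⟩
  (n ∸ 1) C j + ∑[ suc (suc j) ⋯ u ] (n C_)
    ≡⟨ cong (λ a → (n ∸ 1) C j + ∑[ a ⋯ u ] (n C_)) (+-comm 1 (suc j)) ⟩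
  (n ∸ 1) C j + ∑[ suc j + 1 ⋯ u ] (n C_) ∎
  where open ≡-Reasoning

starOrLarge-image : ∀ {k u} (π : Permutation′ n) (x : Fin n) (X : Subset n) →
  StarOrLarge k u (π ⟨$⟩ˡ x) X ⇔ StarOrLarge k u x (image π X)
starOrLarge-image π x X rewrite ∣image∣ π X = mk⇔
  (λ { (inj₁ (e , x∈)) → inj₁ (e , ∈-image⁺ π X x x∈) ; (inj₂ l) → inj₂ l })
  (λ { (inj₁ (e , x∈)) → inj₁ (e , ∈-image⁻ π X x x∈) ; (inj₂ l) → inj₂ l })

sizeIn-image : ∀ {a u} (π : Permutation′ n) (X : Subset n) → SizeIn a u X ⇔ SizeIn a u (image π X)
sizeIn-image π X rewrite ∣image∣ π X = mk⇔ (λ p → p) (λ p → p)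

-- The common end of both parities. The `E i` are the copies of `G`, all of size `b`: one per centre
-- for even s, a single one for odd s. If `F` lies in some `E i`, then equal size forces `F` to be
-- that copy.
bound-with-equality-case : ∀ {b} (F : Family n) (G : Pred (Subset n) 0ℓ) {I : Set} {E : I → Pred (Subset n) 0ℓ}
  (E? : ∀ i → Decidable (E i)) → (∀ i → count (E? i) ≡ b) →
  (∀ i → ∃ λ π → ∀ X → E i X ⇔ G (image π X)) →
  (∀ π → ∃ λ i → ∀ X → E i X ⇔ G (image π X)) →
  ∣ F ∣ᶠ < b ⊎ (∃ λ i → ∀ X → X ∈ᶠ F → E i X) →
  ∣ F ∣ᶠ ≤ b × (∣ F ∣ᶠ ≡ b ⇔ F ≅ G)
bound-with-equality-case {b = b} F G E? count-E to from dichotomy = bound dichotomy , mk⇔ (⇒ dichotomy) ⇐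
  where
  open Equivalence renaming (to to fwd; from to bwd)
  bound : _ → ∣ F ∣ᶠ ≤ b
  bound (inj₁ <b) = <⇒≤ <b
  bound (inj₂ (i , F⊆E)) = subst₂ _≤_ (count-family F) (count-E i) (count-mono (_∈?ᶠ F) (E? i) F⊆E)
  ⇒ : _ → ∣ F ∣ᶠ ≡ b → F ≅ G
  ⇒ (inj₁ <b) ≡b = contradiction ≡b (<⇒≢ <b)
  ⇒ (inj₂ (i , F⊆E)) ≡b = let (π , E⇔G) = to i in π , λ X → mk⇔
    (λ X∈F → fwd (E⇔G X) (F⊆E X X∈F))
    (λ g → count-≡⇒⊇ (_∈?ᶠ F) (E? i) F⊆E (trans (count-family F) (trans ≡b (sym (count-E i)))) X (bwd (E⇔G X) g))
  ⇐ : F ≅ G → ∣ F ∣ᶠ ≡ b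
  ⇐ (π , F⇔G) = let (i , E⇔G) = from π in trans (sym (count-family F)) (trans
    (count-cong (_∈?ᶠ F) (E? i) (λ X X∈F → bwd (E⇔G X) (fwd (F⇔G X) X∈F)) (λ X e → bwd (F⇔G X) (fwd (E⇔G X) e)))
    (count-E i))

-- The two parities for large n.

sufficient : ℕ → ℕ
-- The summands serve, in order, a small member for odd s, a small member for even s, and the
-- comparison `k²C<C`.
sufficient k = threshold k + threshold (suc k) + (2 + k * k * k)

odd-case : ∀ {n u m} → let k = suc m in threshold k ≤ n → k ≤ u →
  (F : Family n) → F ⊆[≤ u ] → [2, 2 * k ∸ 1 ]-ConditionallyIntersecting F →
  let bound = ∑[ k ⋯ u ] (n C_) in
  (∣ F ∣ᶠ ≤ bound) × (∣ F ∣ᶠ ≡ bound ⇔ F ≅ OddExtremal n k u)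
odd-case {n} {u} {m} N≤n k≤u F F≤u ci =
  -- The odd extremal family is invariant under all permutations, so the index type has one element.
  bound-with-equality-case F (OddExtremal n (suc m) u) {I = Unit} (λ _ → sizeIn? (suc m) u)
    (λ _ → count-sizeIn n (suc m) u (m≤n⇒m≤1+n k≤u))
    (λ _ → idₚ , sizeIn-image idₚ)
    (λ π → tt , sizeIn-image π)
    (case Any.any? (λ A → ∣ A ∣ <? suc m) (members F) of λ
      { (yes small) → let (A , A∈F , ∣A∣≤m) = find small in
          inj₁ (subst (∣ F ∣ᶠ <_) (count-sizeIn n (suc m) u (m≤n⇒m≤1+n k≤u))
            (small-member⇒small-family F N≤n k≤u F≤u A∈F ∣A∣≤m λ {B} B∈F ∣B∣≡k →
              -- Here ∣A∣ ≤ k - 1 and ∣B∣ = k, so the union has at most 2k - 1 = s elements.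
              ci A∈F B∈F (≤-trans (∣p∪q∣≤∣p∣+∣q∣ A B)
                (+-mono-≤ (s≤s⁻¹ ∣A∣≤m) (≤-reflexive (trans ∣B∣≡k (sym (+-identityʳ (suc m)))))))))
      ; (no none-small) → inj₂ (tt , λ X X∈F → ≮⇒≥ (λ <k → none-small (lose X∈F <k)) , F≤u X∈F) })

even-case : ∀ {n u j} .{{_ : NonZero n}} → let k = suc (suc j) in sufficient k ≤ n → k < u →
  (F : Family n) → F ⊆[≤ u ] → [2, 2 * k ]-ConditionallyIntersecting F →
  let bound = (n ∸ 1) C (k ∸ 1) + ∑[ k + 1 ⋯ u ] (n C_) in
  (∣ F ∣ᶠ ≤ bound) × (∣ F ∣ᶠ ≡ bound ⇔ F ≅ EvenExtremal n k u)
even-case {n@(suc _)} {u} {j} N≤n k<u F F≤u ci =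
  bound-with-equality-case F (EvenExtremal n k u) (starOrLarge? k u) (λ x → count-starOrLarge (suc j) u x (<⇒≤ k<u))
    -- Swapping `x` with the first element moves the centre to 1.
    (λ x → transpose x zero , starOrLarge-image (transpose x zero) zero)
    (λ π → π ⟨$⟩ˡ zero , starOrLarge-image π zero)
    (case Any.any? (λ A → ∣ A ∣ <? k) (members F) of λ
      { (yes small) → inj₁ (few-if-small (find small))
      ; (no none-small) → by-center (λ X X∈F → ≮⇒≥ (λ <k → none-small (lose X∈F <k))) (Fin.any? center?) })
  where
  open ≤-Reasoning
  k = suc (suc j)
  bound = (n ∸ 1) C (k ∸ 1) + ∑[ k + 1 ⋯ u ] (n C_)

  -- Sizes at most k - 1 and exactly k + 1 add up to at most 2k, so `A` meets every (k + 1)-element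
  -- member. The family is then smaller than the layers k + 1 to u alone.
  few-if-small : (∃ λ A → A ∈ᶠ F × ∣ A ∣ < k) → ∣ F ∣ᶠ < bound
  few-if-small (A , A∈F , ∣A∣<k) = begin-strict
    ∣ F ∣ᶠ
      <⟨ small-member⇒small-family F (≤-trans (≤-trans (m≤n+m _ (threshold k)) (m≤m+n _ _)) N≤n)
           k<u F≤u A∈F (m<n⇒m<1+n ∣A∣<k) (λ {B} B∈F ∣B∣≡1+k → ci A∈F B∈F (begin
             ∣ A ∪ B ∣        ≤⟨ ∣p∪q∣≤∣p∣+∣q∣ A B ⟩
             ∣ A ∣ + ∣ B ∣    ≡⟨ cong (∣ A ∣ +_) ∣B∣≡1+k ⟩
             ∣ A ∣ + suc k    ≡⟨ +-suc ∣ A ∣ k ⟩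
             suc ∣ A ∣ + k    ≤⟨ +-mono-≤ ∣A∣<k (≤-reflexive (sym (+-identityʳ k))) ⟩
             2 * k            ∎)) ⟩
    count (sizeIn? {n} (suc k) u)
      ≤⟨ count-mono {n} (sizeIn? (suc k) u) (starOrLarge? k u zero) (λ _ → inj₂) ⟩
    count (starOrLarge? k u (zero {n ∸ 1}))
      ≡⟨ count-starOrLarge {n} (suc j) u zero (<⇒≤ k<u) ⟩
    bound ∎

  -- If no member has k elements, every point is vacuously a centre.
  center? : (x : Fin n) → Dec (All.All (λ X → ∣ X ∣ ≡ k → x ∈ X) (members F))
  center? x = All.all? (λ X → (∣ X ∣ ≟ k) →-dec (x ∈? X)) (members F)

  layer? : Decidable {A = Subset n} λ X → X ∈ᶠ F × ∣ X ∣ ≡ k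
  layer? X = (X ∈?ᶠ F) ×-dec (∣ X ∣ ≟ k)

  layer-intersecting : ∀ X Y → X ∈ᶠ F × ∣ X ∣ ≡ k → Y ∈ᶠ F × ∣ Y ∣ ≡ k → Nonempty (X ∩ Y)
  layer-intersecting X Y (X∈F , ∣X∣≡k) (Y∈F , ∣Y∣≡k) = ci X∈F Y∈F (begin
    ∣ X ∪ Y ∣      ≤⟨ ∣p∪q∣≤∣p∣+∣q∣ X Y ⟩
    ∣ X ∣ + ∣ Y ∣  ≡⟨ cong₂ _+_ ∣X∣≡k (trans ∣Y∣≡k (sym (+-identityʳ k))) ⟩
    2 * k          ∎)

  -- A search through the finite list turns the failure of a universal statement into a witness.
  avoiding : ∀ x → ¬ All.All (λ X → ∣ X ∣ ≡ k → x ∈ X) (members F) → ∃ λ B → (B ∈ᶠ F × ∣ B ∣ ≡ k) × x ∉ B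
  avoiding x ¬center with Any.any? (λ X → (∣ X ∣ ≟ k) ×-dec ¬? (x ∈? X)) (members F)
  ... | yes some = let (B , B∈F , ∣B∣≡k , x∉B) = find some in B , (B∈F , ∣B∣≡k) , x∉B
  ... | no none = contradiction
    (All.tabulate λ {X} X∈F e → decidable-stable (x ∈? X) λ x∉X → none (lose X∈F (e , x∉X))) ¬center

  by-center : (∀ X → X ∈ᶠ F → k ≤ ∣ X ∣) →
    Dec (∃ λ x → All.All (λ X → ∣ X ∣ ≡ k → x ∈ X) (members F)) →
    ∣ F ∣ᶠ < bound ⊎ (∃ λ x → ∀ X → X ∈ᶠ F → StarOrLarge k u x X)
  by-center k≤ (yes (x , center)) = inj₂ (x , λ X X∈F → case ∣ X ∣ ≟ k of λ
    { (yes e) → inj₁ (e , All.lookup center X∈F e)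
    ; (no ne) → inj₂ (≤∧≢⇒< (k≤ X X∈F) (ne ∘ sym) , F≤u X∈F) })
  by-center k≤ (no no-center) = inj₁ (begin-strict
    ∣ F ∣ᶠ
      ≡⟨ count-family F ⟨
    count (_∈?ᶠ F)
      ≤⟨ count-mono (_∈?ᶠ F) (layer? U.∪? sizeIn? (suc k) u) (λ X X∈F → case ∣ X ∣ ≟ k of λ
           { (yes e) → inj₁ (X∈F , e)
           ; (no ne) → inj₂ (≤∧≢⇒< (k≤ X X∈F) (ne ∘ sym) , F≤u X∈F) }) ⟩
    count (layer? U.∪? sizeIn? (suc k) u)
      ≤⟨ count-∪-≤ layer? (sizeIn? (suc k) u) ⟩
    count layer? + count (sizeIn? {n} (suc k) u)
      -- Only the k-element members are estimated; the larger ones are bounded by all sets of sizes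
      -- k + 1 to u.
      ≤⟨ +-monoˡ-≤ _ (count-nontrivial-intersecting layer? zero (λ _ → proj₂) layer-intersecting
           (λ x → avoiding x (λ center → no-center (x , center)))) ⟩
    k * (k * ((n ∸ 2) C j)) + count (sizeIn? {n} (suc k) u)
      <⟨ +-monoˡ-< _ (k²C<C (≤-trans (m≤n+m _ (threshold k + threshold (suc k))) N≤n)) ⟩
    (n ∸ 1) C (k ∸ 1) + count (sizeIn? {n} (suc k) u)
      ≡⟨ cong ((n ∸ 1) C (k ∸ 1) +_) (trans (count-sizeIn n (suc k) u (m≤n⇒m≤1+n k<u))
           (cong (λ a → ∑[ a ⋯ u ] (n C_)) (+-comm 1 k))) ⟩
    bound ∎)

-- Recovering k from s.

⌈2k/2⌉≡k : ∀ k → ⌈ 2 * k /2⌉ ≡ k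
⌈2k/2⌉≡k k = trans (cong (λ t → ⌈ k + t /2⌉) (+-identityʳ k)) (sym (n≡⌈n+n/2⌉ k))

-- ⌈t/2⌉ unfolds to ⌊(t + 1)/2⌋, and the added one cancels the subtracted one.
⌈[2k∸1]/2⌉≡k : ∀ m → ⌈ 2 * suc m ∸ 1 /2⌉ ≡ suc m
⌈[2k∸1]/2⌉≡k m = trans (cong (λ t → ⌊ suc m + t /2⌋) (+-identityʳ (suc m))) (sym (n≡⌊n+n/2⌋ (suc m)))

theorem27 : ∀ (s : ℕ) → .{{_ : NonZero s}} →
    ∃ λ (n₀ : ℕ) →
    ∀ (n u k : ℕ) → .{{_ : NonZero n}} → .{{_ : NonZero u}} → .{{_ : NonZero k}} →
    n₀ ≤ n →
    s < 2 * u → u < s ∸ 1 →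
    (F : Family n) → F ⊆[≤ u ] → [2, s ]-ConditionallyIntersecting F →
    (s ≡ 2 * k →
    let bound = (n ∸ 1) C (k ∸ 1) + ∑[ k + 1 ⋯ u ] (λ i → n C i) in
    (∣ F ∣ᶠ ≤ bound) × (∣ F ∣ᶠ ≡ bound ⇔ F ≅ EvenExtremal n k u))
    ×
    (s ≡ 2 * k ∸ 1 →
    let bound = ∑[ k ⋯ u ] (λ i → n C i) in
    (∣ F ∣ᶠ ≤ bound) × (∣ F ∣ᶠ ≡ bound ⇔ F ≅ OddExtremal n k u))
-- The threshold may depend on s only; in either parity k is ⌈s/2⌉.
theorem27 s = sufficient ⌈ s /2⌉ , λ n u k N≤n s<2u u<s∸1 F F≤u ci →
  even n u k N≤n s<2u u<s∸1 F F≤u ci , odd n u k N≤n s<2u u<s∸1 F F≤u ci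
  where
  even : ∀ n u k → .{{_ : NonZero n}} → sufficient ⌈ s /2⌉ ≤ n → s < 2 * u → u < s ∸ 1 →
    (F : Family n) → F ⊆[≤ u ] → [2, s ]-ConditionallyIntersecting F → s ≡ 2 * k →
    let bound = (n ∸ 1) C (k ∸ 1) + ∑[ k + 1 ⋯ u ] (λ i → n C i) in
    (∣ F ∣ᶠ ≤ bound) × (∣ F ∣ᶠ ≡ bound ⇔ F ≅ EvenExtremal n k u)
  even n u zero N≤n s<2u () F F≤u ci refl
  -- For k = 1, s = 2 forces u = 0, against s < 2u. Hence k ≥ 2, and C(n - 2, k - 2) makes sense.
  even n u (suc zero) N≤n s<2u (s≤s z≤n) F F≤u ci refl = contradiction s<2u λ ()
  even n u k@(suc (suc j)) N≤n s<2u _ F F≤u ci refl =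
    even-case (subst (λ k → sufficient k ≤ n) (⌈2k/2⌉≡k k) N≤n) (*-cancelˡ-< 2 k u s<2u) F F≤u ci

  odd : ∀ n u k → sufficient ⌈ s /2⌉ ≤ n → s < 2 * u → u < s ∸ 1 →
    (F : Family n) → F ⊆[≤ u ] → [2, s ]-ConditionallyIntersecting F → s ≡ 2 * k ∸ 1 →
    let bound = ∑[ k ⋯ u ] (λ i → n C i) in
    (∣ F ∣ᶠ ≤ bound) × (∣ F ∣ᶠ ≡ bound ⇔ F ≅ OddExtremal n k u)
  odd n u zero N≤n s<2u () F F≤u ci refl
  odd n u k@(suc m) N≤n s<2u _ F F≤u ci refl = odd-case
    (≤-trans (≤-trans (m≤m+n _ _) (m≤m+n _ _)) (subst (λ k → sufficient k ≤ n) (⌈[2k∸1]/2⌉≡k m) N≤n))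
    -- With s = 2k - 1 the inequality s < 2u unfolds to 2k ≤ 2u.
    (*-cancelˡ-≤ 2 s<2u) F F≤u ci
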